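{- Up to isomorphism, there is exactly one regular $2$-balanced $5$-partite tournament that has no strong partition.
   Context: A $2$-balanced $5$-partite tournament is an orientation of the complete $5$-partite graph with all parts of size $2$; it is regular if every vertex has in-degree equal to out-degree. A partition into maximal tournaments is a pair of vertex-disjoint tournaments of order $5$ covering all vertices (each containing one vertex from each partite set); it is a strong partition if both tournaments are strongly connected. -}

module Defs where

open import Data.Nat using (ℕ; zero; suc; _+_)
open import Data.Bool using (Bool; true; false; not; if_then_else_)
open import Data.Fin using (Fin; _≟_)
open import Data.Product using (_×_; _,_; proj₁; proj₂; Σ)
open import Data.List using (List; map; concatMap; allFin)
open import Data.Nat.ListAction using (sum)
open import Relation.Nullary using (¬_)
open import Relation.Nullary.Decidable using (⌊_⌋)
open import Relation.Binary.PropositionalEquality using (_≡_; _≢_)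
open import Function.Bundles using (_↔_; Inverse)

-- Vertices of the complete 5-partite graph with all parts of size 2:
-- vertex (i , a) is the a-th vertex of the i-th partite set.
V : Set
V = Fin 5 × Fin 2

part : V → Fin 5
part = proj₁

Digraph : Set
Digraph = V → V → Bool

Is2Balanced5PartiteTournament : Digraph → Set
Is2Balanced5PartiteTournament D =
  (∀ u v → part u ≡ part v → D u v ≡ false) ×
  (∀ u v → part u ≢ part v → D v u ≡ not (D u v))

allV : List V
allV = concatMap (λ i → map (λ a → (i , a)) (allFin 2)) (allFin 5)

count : (V → Bool) → ℕ
count P = sum (map (λ v → if P v then 1 else 0) allV)

outdeg indeg : Digraph → V → ℕ
outdeg D u = count (λ v → D u v)
indeg  D u = count (λ v → D v u)

Regular : Digraph → Set
Regular D = ∀ u → indeg D u ≡ outdeg D u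

data Path (D : Digraph) (S : V → Bool) : V → V → Set where
  here : ∀ {u} → Path D S u u
  step : ∀ {u w v} → S w ≡ true → D u w ≡ true → Path D S w v → Path D S u v

StronglyConnectedOn : Digraph → (V → Bool) → Set
StronglyConnectedOn D S =
  ∀ u v → S u ≡ true → S v ≡ true → Path D S u v

-- A partition into maximal tournaments: two vertex-disjoint tournaments
-- of order 5 covering V, each containing one vertex of each partite set.
-- Such a partition is determined by c : Fin 5 → Fin 2; the first
-- tournament is {(i , c i)}, the second is {(i , a) | a ≠ c i}.
Partition : Set
Partition = Fin 5 → Fin 2

first second : Partition → V → Bool
first  c (i , a) = ⌊ a ≟ c i ⌋
second c (i , a) = not ⌊ a ≟ c i ⌋

StrongPartition : Digraph → Partition → Set
StrongPartition D c =
  StronglyConnectedOn D (first c) × StronglyConnectedOn D (second c)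

HasStrongPartition : Digraph → Set
HasStrongPartition D = Σ Partition (StrongPartition D)

Isomorphic : Digraph → Digraph → Set
Isomorphic D D' =
  Σ (V ↔ V) λ f → ∀ u v → D' (Inverse.to f u) (Inverse.to f v) ≡ D u v

Good : Digraph → Set
Good D = Is2Balanced5PartiteTournament D × Regular D × ¬ HasStrongPartition D

{-# OPTIONS --safe #-}
module Submission where

-- In a regular tournament of this kind every vertex has outdegree 4, so it is determined by an
-- exhaustive search that adds the arcs of one part after the other.  Swapping two parts, or the
-- two vertices of a part, preserves everything; hence one may assume that none of these moves
-- decreases a key, which rewards common outneighbours of the vertices of part 0 and orders the
-- other vertices by their adjacency to part 0.  A branch of the search ends as soon as the known
-- arcs show that a move decreases the key, or already make both halves of some partition strong.
-- The six tournaments that survive are D₀ with its last three parts permuted.  For each partition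
-- of D₀, a set of vertices of one half without arcs to the rest of that half is exhibited.

open import Defs
open import Data.Bool using (Bool; true; false; not; _∧_; _∨_; if_then_else_; T; T?) renaming (_≟_ to _≟ᵇ_)
open import Data.Bool.ListAction using (any; all)
open import Data.Bool.Properties using (T-≡; T-∧; T-∨)
open import Data.Fin using (Fin; zero; suc; toℕ; opposite; _≟_)
open import Data.Fin.Patterns using (0F; 1F; 2F; 3F; 4F)
open import Data.Fin.Permutation.Components using (transpose)
open import Data.Fin.Properties using (all?; any?; opposite-involutive; suc-injective)
open import Data.Fin.Subset using (Subset)
open import Data.Fin.Subset.Properties using (anySubset?)
open import Data.List using (List; []; _∷_; _++_; map; allFin; foldl)
open import Data.List.Membership.Propositional using (_∈_; lose)
open import Data.List.Membership.Propositional.Properties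
  using (∈-map⁺; ∈-++⁺ˡ; ∈-++⁺ʳ; ∈-allFin; ∈-concatMap⁺)
open import Data.List.Membership.Propositional.Properties.WithK using (unique∧set⇒bag)
open import Data.List.Properties using (map-cong; map-∘)
open import Data.List.Relation.Binary.BagAndSetEquality using (∼bag⇒↭)
open import Data.List.Relation.Binary.Permutation.Propositional using (_↭_)
import Data.List.Relation.Binary.Permutation.Propositional.Properties as ↭
open import Data.List.Relation.Unary.All as All using (All; []; _∷_)
import Data.List.Relation.Unary.All.Properties as All
open import Data.List.Relation.Unary.Any as Any using (Any)
import Data.List.Relation.Unary.Any.Properties as Any
open import Data.List.Relation.Unary.Unique.Propositional using (Unique)
import Data.List.Relation.Unary.Unique.Propositional.Properties as Unique
import Data.List.Relation.Unary.Unique.DecPropositional as DecUnique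
open import Data.Nat using (ℕ; zero; suc; _+_; _*_; _∸_; _≤_; _<_; s≤s; z<s; _≤ᵇ_; _<ᵇ_; _≡ᵇ_; _<?_)
open import Data.Nat.Induction using (Acc; acc; <-wellFounded)
open import Data.Nat.ListAction using (sum)
open import Data.Nat.ListAction.Properties using (sum-↭)
open import Data.Nat.Properties
  using (+-assoc; +-identityʳ; +-commutativeSemigroup; *-cancelˡ-≡; m+n∸m≡n; m≤m+n; ≤⇒≤ᵇ; <ᵇ⇒<; ≡ᵇ⇒≡; ≤-reflexive; ≤-trans)
  renaming (_≟_ to _≟ℕ_)
open import Data.Product using (Σ; ∃; _×_; _,_; proj₁; proj₂)
open import Data.Product.Properties using (≡-dec)
open import Data.Sum as Sum using (_⊎_; inj₁; inj₂; [_,_]′)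
open import Data.Unit using (tt)
open import Data.Vec using (Vec; []; _∷_; lookup; tabulate; replicate)
open import Data.Vec.Properties using (lookup∘tabulate; lookup-replicate)
open import Function using (_∘_; id; flip; Equivalence; mk↔ₛ′; mk⇔)
open import Function.Properties.Inverse using (↔-refl; ↔-trans)
open import Relation.Binary.PropositionalEquality
  using (_≡_; _≢_; refl; sym; trans; cong; cong₂; subst; subst₂; module ≡-Reasoning)
open import Relation.Nullary using (¬_; Dec; yes; no; contradiction)
open import Relation.Nullary.Decidable using (⌊_⌋; dec-true; isYes≗does; map′; from-yes; ¬?; _×-dec_; _⊎-dec_; _→-dec_)

open import Algebra.Properties.CommutativeSemigroup +-commutativeSemigroup using (interchange)

private variable
  n : ℕ
  A B : Set

-- Boolean tests and the propositions they decide

∧⁻ : ∀ x {y} → T (x ∧ y) → T x × T y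
∧⁻ _ = Equivalence.to T-∧

∨⁻ : ∀ x {y} → T (x ∨ y) → T x ⊎ T y
∨⁻ _ = Equivalence.to T-∨

any-map⁻ : (p : B → Bool) (f : A → B) (xs : List A) →
           T (any p (map f xs)) → Any (λ x → T (p (f x))) xs
any-map⁻ p f xs h = Any.map⁻ (Any.any⁻ p (map f xs) h)

≡true : ∀ {b} → T b → b ≡ true
≡true = Equivalence.to T-≡

T-true : ∀ {b} → b ≡ true → T b
T-true = Equivalence.from T-≡

-- Graphs on n parts of size 2

Vertex : ℕ → Set
Vertex n = Fin n × Fin 2

Graph : ℕ → Set
Graph n = Vertex n → Vertex n → Bool

IsTournament : Graph n → Set
IsTournament E =
  (∀ u v → proj₁ u ≡ proj₁ v → E u v ≡ false) ×
  (∀ u v → proj₁ u ≢ proj₁ v → E v u ≡ not (E u v))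

shift : Vertex n → Vertex (suc n)
shift (i , a) = suc i , a

restrict : Graph (suc n) → Graph n
restrict E u v = E (shift u) (shift v)

restrict-tournament : {E : Graph (suc n)} → IsTournament E → IsTournament (restrict E)
restrict-tournament (same , diff) =
  (λ u v eq → same (shift u) (shift v) (cong suc eq)) ,
  (λ u v neq → diff (shift u) (shift v) (neq ∘ suc-injective))

at : Vec (A × A) n → Vertex n → A
at xs (j , 0F) = proj₁ (lookup xs j)
at xs (j , 1F) = proj₂ (lookup xs j)

pairs : (Vertex n → A) → Vec (A × A) n
pairs f = tabulate λ j → f (j , 0F) , f (j , 1F)

at-pairs : (f : Vertex n → A) → ∀ v → at (pairs f) v ≡ f v
at-pairs f (j , 0F) = cong proj₁ (lookup∘tabulate _ j)
at-pairs f (j , 1F) = cong proj₂ (lookup∘tabulate _ j)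

bit : Bool → ℕ
bit b = if b then 1 else 0

degree : ∀ n → (Vertex n → Bool) → ℕ
degree zero    f = 0
degree (suc n) f = bit (f (0F , 0F)) + (bit (f (0F , 1F)) + degree n (f ∘ shift))

-- Partial orientations: the arcs at the first few parts are known

Row : ℕ → Set
Row n = Vec (Bool × Bool) n

-- The two rows hold the arcs between the first part and the later ones; the last argument orients
-- the later parts among themselves.
data Orientation : ℕ → Set where
  unknown : Orientation n
  extend  : Row n → Row n → Orientation n → Orientation (suc n)

known : Orientation n → ℕ
known unknown        = 0
known (extend _ _ o) = suc (known o)

-- A pair that is not yet oriented gets no arc in either direction, so `arc o` is a subgraph of
-- every tournament that completes `o`.
arc : Orientation n → Graph n
arc unknown        _            _            = false
arc (extend a b o) (zero  , _)  (zero  , _)  = false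
arc (extend a b o) (zero  , 0F) (suc j , y)  = at a (j , y)
arc (extend a b o) (zero  , 1F) (suc j , y)  = at b (j , y)
arc (extend a b o) (suc i , x)  (zero  , 0F) = not (at a (i , x))
arc (extend a b o) (suc i , x)  (zero  , 1F) = not (at b (i , x))
arc (extend a b o) (suc i , x)  (suc j , y)  = arc o (i , x) (j , y)

data _⊑_ : Orientation n → Orientation n → Set where
  unknown : {o : Orientation n} → unknown ⊑ o
  extend  : ∀ a b {o o′ : Orientation n} → o ⊑ o′ → extend a b o ⊑ extend a b o′

row : Graph (suc n) → Fin 2 → Row n
row E x = pairs (E (0F , x) ∘ shift)

encode : Graph n → Orientation n
encode {zero}  E = unknown
encode {suc n} E = extend (row E 0F) (row E 1F) (encode (restrict E))

-- Arcs at a known part are final, and an arc that is present is never a placeholder. The first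
-- alternative serves the keys, the second strong connectivity and the comparison with `D₀`.
arc-agrees : {E : Graph n} {o : Orientation n} → IsTournament E → o ⊑ encode E →
             ∀ u v → toℕ (proj₁ u) < known o ⊎ T (arc o u v) → arc o u v ≡ E u v
arc-agrees {zero}      _ _              (() , _)     _            _
arc-agrees {suc n}     t unknown        _            _            (inj₁ ())
arc-agrees {suc n}     t unknown        _            _            (inj₂ ())
arc-agrees {suc n}     t (extend _ _ s) (zero  , x)  (zero  , y)  _ = sym (proj₁ t _ _ refl)
arc-agrees {suc n} {E} t (extend _ _ s) (zero  , 0F) (suc j , y)  _ = at-pairs (E (0F , 0F) ∘ shift) (j , y)
arc-agrees {suc n} {E} t (extend _ _ s) (zero  , 1F) (suc j , y)  _ = at-pairs (E (0F , 1F) ∘ shift) (j , y)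
arc-agrees {suc n} {E} t (extend _ _ s) (suc i , x)  (zero  , 0F) _ =
  trans (cong not (at-pairs (E (0F , 0F) ∘ shift) (i , x))) (sym (proj₂ t _ _ λ ()))
arc-agrees {suc n} {E} t (extend _ _ s) (suc i , x)  (zero  , 1F) _ =
  trans (cong not (at-pairs (E (0F , 1F) ∘ shift) (i , x))) (sym (proj₂ t _ _ λ ()))
arc-agrees {suc n}     t (extend _ _ s) (suc i , x)  (suc j , y)  h =
  arc-agrees (restrict-tournament t) s (i , x) (j , y) (Sum.map₁ (λ { (s≤s p) → p }) h)

arc-sound : {E : Graph n} {o : Orientation n} → IsTournament E → o ⊑ encode E →
            ∀ {u v} → T (arc o u v) → T (E u v)
arc-sound t s h = subst T (arc-agrees t s _ _ (inj₂ h)) h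

-- Moves of the vertices and relabelled digraphs

-- Every move is an involution and so serves as its own inverse.
data Move : Set where
  flipPart : Fin 5 → Move
  exchange : Fin 5 → Fin 5 → Move

movePart : Move → Fin 5 → Fin 5
movePart (flipPart _)   = id
movePart (exchange i j) = transpose i j

moveSide : Move → Fin 5 → Fin 2 → Fin 2
moveSide (flipPart k)   i a = if ⌊ i ≟ k ⌋ then opposite a else a
moveSide (exchange _ _) _ a = a

move : Move → V → V
move m (i , a) = movePart m i , moveSide m i a

relabel : Move → Digraph → Digraph
relabel m D u v = D (move m u) (move m v)

relabelAll : List Move → Digraph → Digraph
relabelAll ms D = foldl (flip relabel) D ms

movePart-involutive : ∀ m i → movePart m (movePart m i) ≡ i
movePart-involutive (flipPart _)   _ = refl
movePart-involutive (exchange i j) k =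
  from-yes (all? λ i → all? λ j → all? λ k → transpose {5} i j (transpose i j k) ≟ k) i j k

movePart-injective : ∀ m {i j} → movePart m i ≡ movePart m j → i ≡ j
movePart-injective m {i} {j} eq =
  trans (sym (movePart-involutive m i)) (trans (cong (movePart m) eq) (movePart-involutive m j))

moveSide-cancel : ∀ m i a → moveSide m (movePart m i) (moveSide m i a) ≡ a
moveSide-cancel (exchange _ _) i a = refl
moveSide-cancel (flipPart k)   i a with ⌊ i ≟ k ⌋
... | true  = opposite-involutive a
... | false = refl

move-involutive : ∀ m v → move m (move m v) ≡ v
move-involutive m (i , a) = cong₂ _,_ (movePart-involutive m i) (moveSide-cancel m i a)

moveSide-≟ : ∀ m i a b → ⌊ moveSide m i a ≟ moveSide m i b ⌋ ≡ ⌊ a ≟ b ⌋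
moveSide-≟ (exchange _ _) i a b = refl
moveSide-≟ (flipPart k)   i a b with ⌊ i ≟ k ⌋
... | false = refl
moveSide-≟ (flipPart k) i 0F 0F | true = refl
moveSide-≟ (flipPart k) i 0F 1F | true = refl
moveSide-≟ (flipPart k) i 1F 0F | true = refl
moveSide-≟ (flipPart k) i 1F 1F | true = refl

relabel-tournament : ∀ m {D} → IsTournament D → IsTournament (relabel m D)
relabel-tournament m (same , diff) =
  (λ u v eq → same _ _ (cong (movePart m) eq)) ,
  (λ u v neq → diff _ _ (neq ∘ movePart-injective m))

∈-allV : ∀ v → v ∈ allV
∈-allV (i , a) = ∈-concatMap⁺ (λ j → map (j ,_) (allFin 2)) (lose (∈-allFin i) (∈-map⁺ (i ,_) (∈-allFin a)))

allV-unique : Unique allV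
allV-unique = from-yes (DecUnique.unique? (≡-dec _≟_ _≟_) allV)

-- Both lists are free of repetitions and contain every vertex.
move-allV : ∀ m → map (move m) allV ↭ allV
move-allV m = ∼bag⇒↭ (unique∧set⇒bag (Unique.map⁺ injective allV-unique) allV-unique
  (mk⇔ (λ _ → ∈-allV _) (λ _ → ∈-image _)))
  where
  ∈-image : ∀ v → v ∈ map (move m) allV
  ∈-image v = subst (_∈ map (move m) allV) (move-involutive m v) (∈-map⁺ (move m) (∈-allV (move m v)))
  injective : ∀ {u v} → move m u ≡ move m v → u ≡ v
  injective {u} {v} eq =
    trans (sym (move-involutive m u)) (trans (cong (move m) eq) (move-involutive m v))

count-move : ∀ m P → count (P ∘ move m) ≡ count P
count-move m P = trans (cong sum (map-∘ {g = bit ∘ P} {f = move m} allV)) (sum-↭ (↭.map⁺ (bit ∘ P) (move-allV m)))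

relabel-regular : ∀ m D → Regular D → Regular (relabel m D)
relabel-regular m D reg u =
  trans (count-move m (λ v → D v (move m u)))
 (trans (reg (move m u)) (sym (count-move m (D (move m u)))))

Path-relabel : ∀ m {D S S′} → (∀ w → S′ (move m w) ≡ S w) → ∀ {u v} →
               Path (relabel m D) S u v → Path D S′ (move m u) (move m v)
Path-relabel m same here           = here
Path-relabel m same (step s e p) = step (trans (same _) s) e (Path-relabel m same p)

-- The endpoints are moved, joined by a path in the relabelled digraph, and the path is moved back.
StronglyConnectedOn-relabel : ∀ m {D S S′} → (∀ w → S′ (move m w) ≡ S w) →
                              StronglyConnectedOn (relabel m D) S → StronglyConnectedOn D S′
StronglyConnectedOn-relabel m {D} {S} {S′} same sc u v su sv =
  subst (λ w → Path D S′ w v) (move-involutive m u)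
    (subst (Path D S′ _) (move-involutive m v) (Path-relabel m same (sc _ _ (pull u su) (pull v sv))))
  where
  pull : ∀ w → S′ w ≡ true → S (move m w) ≡ true
  pull w sw = trans (sym (same _)) (trans (cong S′ (move-involutive m w)) sw)

movePartition : Move → Partition → Partition
movePartition m c i = moveSide m (movePart m i) (c (movePart m i))

first-move : ∀ m c w → first (movePartition m c) (move m w) ≡ first c w
first-move m c (i , a) = trans
  (cong (λ j → ⌊ moveSide m i a ≟ moveSide m j (c j) ⌋) (movePart-involutive m i))
  (moveSide-≟ m i a (c i))

HasStrongPartition-relabel : ∀ m {D} → HasStrongPartition (relabel m D) → HasStrongPartition D
HasStrongPartition-relabel m (c , sc₁ , sc₂) =
  movePartition m c ,
  StronglyConnectedOn-relabel m (first-move m c) sc₁ ,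
  StronglyConnectedOn-relabel m (cong not ∘ first-move m c) sc₂

relabelAll-good : ∀ ms {D} → Good D → Good (relabelAll ms D)
relabelAll-good []       g                = g
relabelAll-good (m ∷ ms) {D} (t , reg , none) =
  relabelAll-good ms (relabel-tournament m t , relabel-regular m D reg , none ∘ HasStrongPartition-relabel m)

relabelAll-mono : ∀ ms {D E} → (∀ {u v} → T (D u v) → T (E u v)) →
                  ∀ {u v} → T (relabelAll ms D u v) → T (relabelAll ms E u v)
relabelAll-mono []       h = h
relabelAll-mono (m ∷ ms) h = relabelAll-mono ms h

Isomorphic-trans : ∀ {D E F} → Isomorphic D E → Isomorphic E F → Isomorphic D F
Isomorphic-trans (f , p) (g , q) = ↔-trans f g , λ u v → trans (q _ _) (p u v)

relabelAll-isomorphic : ∀ ms {D} → Isomorphic (relabelAll ms D) D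
relabelAll-isomorphic []       = ↔-refl , λ _ _ → refl
relabelAll-isomorphic (m ∷ ms) {D} = Isomorphic-trans {F = D} (relabelAll-isomorphic ms)
  (mk↔ₛ′ (move m) (move m) (move-involutive m) (move-involutive m) , λ _ _ → refl)

-- If `D` lacks an arc between different parts, it has the reverse one; then so does `E`, which
-- therefore lacks the same arc.
subtournament-≡ : {D E : Graph n} → IsTournament D → IsTournament E →
                  (∀ {u v} → T (D u v) → T (E u v)) → ∀ u v → E u v ≡ D u v
subtournament-≡ {D = D} {E} (sameD , diffD) (sameE , diffE) sub u v with proj₁ u ≟ proj₁ v
... | yes eq = trans (sameE u v eq) (sym (sameD u v eq))
... | no neq with D u v in eq
...   | true  = ≡true (sub (T-true eq))
...   | false = trans (diffE v u (neq ∘ sym))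
                      (cong not (≡true (sub (T-true (trans (diffD u v neq) (cong not eq))))))

-- Strong connectivity

Path-concat : ∀ {D S u v w} → Path D S u v → Path D S v w → Path D S u w
Path-concat here         q = q
Path-concat (step s e p) q = step s e (Path-concat p q)

Path-cong : ∀ {D S S′} → (∀ w → S w ≡ S′ w) → ∀ {u v} → Path D S u v → Path D S′ u v
Path-cong same here         = here
Path-cong same (step s e p) = step (trans (sym (same _)) s) e (Path-cong same p)

StronglyConnectedOn-cong : ∀ {D S S′} → (∀ w → S w ≡ S′ w) →
                           StronglyConnectedOn D S → StronglyConnectedOn D S′
StronglyConnectedOn-cong same sc u v su sv =
  Path-cong same (sc u v (trans (same u) su) (trans (same v) sv))

-- k is fuel; s holds the vertices reached but not yet expanded, r and t those not yet reached.
expand : Graph n → ℕ → Vertex n → List (Vertex n) → List (Vertex n) → List (Vertex n) → Bool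
reach  : Graph n → ℕ → List (Vertex n) → List (Vertex n) → Bool

reach E _       _       []           = true
reach E _       []      (_ ∷ _)      = false
reach E zero    (_ ∷ _) (_ ∷ _)      = false
reach E (suc k) (x ∷ s) rest@(_ ∷ _) = expand E k x rest s []

expand E k x []      s t = reach E k s t
expand E k x (w ∷ r) s t = if E x w then expand E k x r (w ∷ s) t else expand E k x r s (w ∷ t)

-- `R` is left abstract so that one argument covers both being reachable from a root and, with all
-- arcs reversed, reaching the root.
module _ {E : Graph n} {R U : Vertex n → Set}
         (extend-R : ∀ {x w} → R x → U w → T (E x w) → R w) where

  expand-sound : ∀ k {x} r {s t} → R x → All U r → All R s → All U t →
                 T (expand E k x r s t) → All R r × All R t
  reach-sound : ∀ k s r → All R s → All U r → T (reach E k s r) → All R r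

  reach-sound _       _       []           _        _  _ = []
  reach-sound (suc k) (x ∷ s) rest@(_ ∷ _) (p ∷ ps) us h =
    proj₁ (expand-sound k rest p us ps [] h)

  expand-sound k []      {s} {t} p _        ps vs h = [] , reach-sound k s t ps vs h
  expand-sound k {x} (w ∷ r) p (u ∷ us) ps vs h with E x w in eq
  ... | true  = let q = extend-R p u (T-true eq)
                    (qs , rs) = expand-sound k r p us (q ∷ ps) vs h
                in q ∷ qs , rs
  ... | false with expand-sound k r p us ps (u ∷ vs) h
  ...   | qs , q ∷ rs = q ∷ qs , rs

-- One root has to reach all vertices and be reached from them. Each unit of fuel expands one
-- vertex, so 5 is enough for a half of a partition.
strong : Graph n → List (Vertex n) → Bool
strong E []      = true
strong E (r ∷ s) = reach E 5 (r ∷ []) s ∧ reach (flip E) 5 (r ∷ []) s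

strong-sound : {D E : Digraph} {S : V → Bool} → (∀ {u v} → T (E u v) → T (D u v)) →
               ∀ xs → All (λ u → S u ≡ true) xs → (∀ u → S u ≡ true → u ∈ xs) →
               T (strong E xs) → StronglyConnectedOn D S
strong-sound sub [] _ complete _ u _ su _ with complete u su
... | ()
strong-sound {D} {E} {S} sub (r ∷ s) (sr ∷ ss) complete h u v su sv =
  Path-concat (proj₂ (All.lookup to-r (complete u su))) (proj₂ (All.lookup from-r (complete v sv)))
  where
  from-r : All (λ w → S w ≡ true × Path D S r w) (r ∷ s)
  from-r = (sr , here) ∷ reach-sound
    (λ { (_ , p) sw e → sw , Path-concat p (step sw (≡true (sub e)) here) })
    5 _ s ((sr , here) ∷ []) ss (proj₁ (∧⁻ (reach E 5 (r ∷ []) s) h))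
  to-r : All (λ w → S w ≡ true × Path D S w r) (r ∷ s)
  to-r = (sr , here) ∷ reach-sound
    (λ { (sx , p) sw e → sw , step sx (≡true (sub e)) p })
    5 _ s ((sr , here) ∷ []) ss (proj₂ (∧⁻ (reach E 5 (r ∷ []) s) h))

transversal : (Fin n → Fin 2) → List (Vertex n)
transversal c = map (λ i → i , c i) (allFin _)

first-transversal : ∀ c → All (λ u → first c u ≡ true) (transversal c)
first-transversal c = All.map⁺ {f = λ i → i , c i}
  (All.universal (λ i → trans (isYes≗does (c i ≟ c i)) (dec-true (c i ≟ c i) refl)) (allFin 5))

transversal-complete : ∀ c u → first c u ≡ true → u ∈ transversal c
transversal-complete c (i , a) s with a ≟ c i
... | yes refl = ∈-map⁺ (λ i → i , c i) (∈-allFin i)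

-- Turns the second half into the first half of the complementary choice, so that one soundness
-- argument serves both halves.
first-opposite : ∀ c u → first (opposite ∘ c) u ≡ second c u
first-opposite c (i , a) with c i
first-opposite c (i , 0F) | 0F = refl
first-opposite c (i , 0F) | 1F = refl
first-opposite c (i , 1F) | 0F = refl
first-opposite c (i , 1F) | 1F = refl

allVecs : ∀ n → List (Vec (Fin 2) n)
allVecs zero    = [] ∷ []
allVecs (suc n) = map (0F ∷_) (allVecs n) ++ map (1F ∷_) (allVecs n)

∈-allVecs : (c : Vec (Fin 2) n) → c ∈ allVecs n
∈-allVecs []       = Any.here refl
∈-allVecs (0F ∷ c) = ∈-++⁺ˡ (∈-map⁺ (0F ∷_) (∈-allVecs c))
∈-allVecs (1F ∷ c) = ∈-++⁺ʳ (map (0F ∷_) (allVecs _)) (∈-map⁺ (1F ∷_) (∈-allVecs c))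

-- A partition is unordered, so the part of (0 , 0) may be taken as the first one.
split : Vec (Fin 2) 4 → List V × List V
split c = transversal (lookup (0F ∷ c)) , transversal (opposite ∘ lookup (0F ∷ c))

bothStrong : Digraph → List V × List V → Bool
bothStrong E (xs , ys) = strong E xs ∧ strong E ys

bothStrong-sound : {D E : Digraph} → (∀ {u v} → T (E u v) → T (D u v)) →
                   ∀ c → T (bothStrong E (split c)) → HasStrongPartition D
bothStrong-sound {D} {E} sub c h =
  part₁ , half part₁ (proj₁ both) ,
  StronglyConnectedOn-cong (first-opposite part₁) (half (opposite ∘ part₁) (proj₂ both))
  where
  part₁ : Partition
  part₁ = lookup (0F ∷ c)
  both : T (strong E (transversal part₁)) × T (strong E (transversal (opposite ∘ part₁)))
  both = ∧⁻ (strong E (transversal part₁)) h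
  half : ∀ c → T (strong E (transversal c)) → StronglyConnectedOn D (first c)
  half c = strong-sound sub (transversal c) (first-transversal c) (transversal-complete c)

-- The exceptional tournament

pattern ⊤⊤ = (true  , true)
pattern ⊤⊥ = (true  , false)
pattern ⊥⊤ = (false , true)
pattern ⊥⊥ = (false , false)

-- Any two of the parts 0, 2, 3, 4 span a directed 4-cycle. Vertex 0 of part 1 dominates parts 0 and
-- 2 and is dominated by parts 3 and 4; for vertex 1 of part 1 it is the reverse.
o₀ : Orientation 5
o₀ = extend (⊥⊤ ∷ ⊥⊤ ∷ ⊥⊤ ∷ ⊥⊤ ∷ []) (⊥⊤ ∷ ⊤⊥ ∷ ⊤⊥ ∷ ⊤⊥ ∷ [])
   ( extend (⊤⊤ ∷ ⊥⊥ ∷ ⊥⊥ ∷ [])      (⊥⊥ ∷ ⊤⊤ ∷ ⊤⊤ ∷ [])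
   ( extend (⊤⊥ ∷ ⊥⊤ ∷ [])           (⊥⊤ ∷ ⊤⊥ ∷ [])
   ( extend (⊤⊥ ∷ [])                (⊥⊤ ∷ [])
   ( extend []                       [] unknown))))

D₀ : Digraph
D₀ = arc o₀

allVertices? : {P : V → Set} → (∀ v → Dec (P v)) → Dec (∀ v → P v)
allVertices? P? = map′ (λ { h (i , a) → h i a }) (λ h i a → h (i , a)) (all? λ i → all? λ a → P? (i , a))

anyVertex? : {P : V → Set} → (∀ v → Dec (P v)) → Dec (∃ P)
anyVertex? P? = map′ (λ { (i , a , p) → (i , a) , p }) (λ { ((i , a) , p) → i , a , p })
                     (any? λ i → any? λ a → P? (i , a))

D₀-tournament : IsTournament D₀
D₀-tournament = from-yes
  (allVertices? (λ u → allVertices? λ v → (part u ≟ part v) →-dec (D₀ u v ≟ᵇ false)) ×-dec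
   allVertices? (λ u → allVertices? λ v → ¬? (part u ≟ part v) →-dec (D₀ v u ≟ᵇ not (D₀ u v))))

D₀-regular : Regular D₀
D₀-regular = from-yes (allVertices? λ u → indeg D₀ u ≟ℕ outdeg D₀ u)

-- A half of a partition has one vertex in each part, so its subsets are described by sets `X` of
-- parts.
inside : (V → Bool) → Subset 5 → V → Bool
inside S X v = S v ∧ lookup X (part v)

outside : (V → Bool) → Subset 5 → V → Bool
outside S X v = S v ∧ not (lookup X (part v))

Cut : Digraph → (V → Bool) → Set
Cut D S = ∃ λ X → ∃ (T ∘ inside S X) × ∃ (T ∘ outside S X) ×
          (∀ u v → T (inside S X u ∧ outside S X v) → ¬ T (D u v))

cut? : ∀ D S → Dec (Cut D S)
cut? D S = anySubset? λ X → anyVertex? (T? ∘ inside S X) ×-dec anyVertex? (T? ∘ outside S X) ×-dec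
  allVertices? λ u → allVertices? λ v → T? (inside S X u ∧ outside S X v) →-dec ¬? (T? (D u v))

-- By induction along the path: a step that left the inside would be a forbidden arc, so the path
-- never arrives outside.
Cut⇒¬Path : ∀ {D S} X → (∀ u v → T (inside S X u ∧ outside S X v) → ¬ T (D u v)) →
            ∀ {u v} → T (inside S X u) → T (outside S X v) → ¬ Path D S u v
Cut⇒¬Path {S = S} X closed {u} i o here with S u | lookup X (part u)
... | true | true = o
Cut⇒¬Path {S = S} X closed {u} i o (step {w = w} s e p) with lookup X (part w) in eq
... | true  = Cut⇒¬Path X closed (Equivalence.from T-∧ (T-true s , T-true eq)) o p
... | false = closed u w (Equivalence.from T-∧ (i , Equivalence.from T-∧ (T-true s , T-true (cong not eq)))) (T-true e)

Cut⇒¬StronglyConnectedOn : ∀ {D S} → Cut D S → ¬ StronglyConnectedOn D S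
Cut⇒¬StronglyConnectedOn (X , (u , i) , (v , o) , closed) sc =
  Cut⇒¬Path X closed i o (sc u v (≡true (proj₁ (∧⁻ _ i))) (≡true (proj₁ (∧⁻ _ o))))

D₀-cuts : All (λ c → Cut D₀ (first (lookup c)) ⊎ Cut D₀ (second (lookup c))) (allVecs 5)
D₀-cuts = from-yes (All.all? (λ c → cut? D₀ (first (lookup c)) ⊎-dec cut? D₀ (second (lookup c))) (allVecs 5))

D₀-noStrongPartition : ¬ HasStrongPartition D₀
D₀-noStrongPartition (c , sc₁ , sc₂) =
  [ (λ cut → Cut⇒¬StronglyConnectedOn cut (StronglyConnectedOn-cong same sc₁))
  , (λ cut → Cut⇒¬StronglyConnectedOn cut (StronglyConnectedOn-cong (cong not ∘ same) sc₂))
  ]′ (All.lookup D₀-cuts (∈-allVecs (tabulate c)))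
  where
  -- The finite check ranges over vectors, so the choice function is compared with its table.
  same : ∀ w → first c w ≡ first (lookup (tabulate c)) w
  same (i , a) = cong (λ x → ⌊ a ≟ x ⌋) (sym (lookup∘tabulate c i))

D₀-good : Good D₀
D₀-good = D₀-tournament , D₀-regular , D₀-noStrongPartition

-- The key of a tournament

-- c counts the pairs (true , true); it outweighs the base-4 number k, as 1048576 = 4 ^ 10.
code : List (Bool × Bool) → ℕ → ℕ → ℕ
code []                    c k = k + (8 ∸ c) * 1048576
code ((true  , true)  ∷ r) c k = code r (suc c) (k * 4 + 3)
code ((true  , false) ∷ r) c k = code r c (k * 4 + 2)
code ((false , true)  ∷ r) c k = code r c (k * 4 + 1)
code ((false , false) ∷ r) c k = code r c (k * 4)

-- Only arcs out of the first two listed vertices enter. Listing the images of the vertices under a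
-- move yields the key of the relabelled digraph without relabelling anything.
keyAlong : Digraph → List V → ℕ
keyAlong D vs@(u ∷ v ∷ _) = code (map (λ w → D u w , D v w) vs) 0 0
keyAlong D _              = 0

key : Digraph → ℕ
key D = keyAlong D allV

key-cong : {D E : Digraph} → (∀ x w → E (0F , x) w ≡ D (0F , x) w) → key E ≡ key D
key-cong eq = cong (λ r → code r 0 0) (map-cong (λ w → cong₂ _,_ (eq 0F w) (eq 1F w)) allV)

keyAlong-move : {D E : Digraph} → ∀ m → (∀ x w → E (move m (0F , x)) w ≡ D (move m (0F , x)) w) →
                keyAlong E (map (move m) allV) ≡ key (relabel m D)
keyAlong-move {D} m eq = cong (λ r → code r 0 0) (trans
  (map-cong (λ w → cong₂ _,_ (eq 0F w) (eq 1F w)) (map (move m) allV))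
  (sym (map-∘ {g = λ w → D (move m (0F , 0F)) w , D (move m (0F , 1F)) w} {f = move m} allV)))

-- exchange 0F 2F is left out: testing it in the search costs more time than its pruning saves.
moves : List Move
moves = flipPart 0F ∷ flipPart 1F ∷ flipPart 2F ∷ flipPart 3F ∷ flipPart 4F
      ∷ exchange 1F 2F ∷ exchange 2F 3F ∷ exchange 3F 4F
      ∷ exchange 0F 1F ∷ exchange 0F 3F ∷ exchange 0F 4F ∷ []

Improvable : Digraph → Set
Improvable D = Any (λ m → key (relabel m D) < key D) moves

-- Each applied move lowers a natural number. A minimum with respect to single moves is all that the
-- pruning relies on.
minimise : ∀ D → Acc _<_ (key D) → Σ (List Move) λ ms → ¬ Improvable (relabelAll ms D)
minimise D (acc rs) with Any.any? (λ m → key (relabel m D) <? key D) moves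
... | no ¬imp = [] , ¬imp
... | yes imp with m , lt ← Any.satisfied imp
              with ms , ¬imp ← minimise (relabel m D) (rs lt) = m ∷ ms , ¬imp

-- Tests that end a branch

-- Nothing that the tables (vertices, their images under the moves, splits) hold depends on
-- the search; they are an argument of it because the type checker evaluates an argument only
-- once, and form a data type because a record value would not be shared.
data Tables : Set where
  mkTables : List V → List (ℕ × List V) → List (List V × List V) → Tables

-- The number is the part that takes the role of part 0: the key after the move depends only on the
-- arcs out of that part.
image : Move → ℕ × List V
image m = toℕ (movePart m 0F) , map (move m) allV

tables : Tables
tables = mkTables allV (map image moves) (map split (allVecs 4))

improves : Orientation 5 → ℕ → ℕ × List V → Bool
-- A move is tested just when part `d` is the last known one: before that its key is not determined,
-- and afterwards the outcome cannot change.
improves o k (d , vs) = (suc d ≡ᵇ known o) ∧ (keyAlong (arc o) vs <ᵇ k)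

improvable : Tables → Orientation 5 → Bool
improvable (mkTables vs is _) o = any (improves o (keyAlong (arc o) vs)) is

improvable-sound : {D : Digraph} {o : Orientation 5} → IsTournament D → o ⊑ encode D →
                   T (improvable tables o) → Improvable D
improvable-sound {D} {o} t s h =
  Any.map {P = λ m → T (improves o (key (arc o)) (image m))} (λ {m} → improved m)
    (any-map⁻ (improves o (key (arc o))) image moves h)
  where
  improved : ∀ m → T (improves o (key (arc o)) (image m)) → key (relabel m D) < key D
  improved m i with d , lt ← ∧⁻ (suc (toℕ (movePart m 0F)) ≡ᵇ known o) i = subst₂ _<_
    (keyAlong-move {D} {arc o} m (λ x w → arc-agrees t s (move m (0F , x)) w (inj₁ d<)))
    (key-cong {D} {arc o} (λ x w → arc-agrees t s (0F , x) w (inj₁ (≤-trans z<s d<))))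
    (<ᵇ⇒< (keyAlong (arc o) (map (move m) allV)) (key (arc o)) lt)
    where
    d< : toℕ (movePart m 0F) < known o
    d< = ≤-reflexive (≡ᵇ⇒≡ (suc (toℕ (movePart m 0F))) (known o) d)

settled : Tables → Orientation 5 → Bool
settled t@(mkTables _ _ ss) o = improvable t o ∨ any (bothStrong (arc o)) ss

-- Both tests survive completion: the compared keys use known arcs only, and further arcs cannot
-- destroy strong connectivity.
settled-sound : {D : Digraph} {o : Orientation 5} → IsTournament D → o ⊑ encode D →
                T (settled tables o) → Improvable D ⊎ HasStrongPartition D
settled-sound {o = o} t s h = Sum.map (improvable-sound t s)
  (λ h′ → let c , both = Any.satisfied (any-map⁻ (bothStrong (arc o)) split (allVecs 4) h′)
          in bothStrong-sound (arc-sound t s) c both)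
  (∨⁻ (improvable tables o) h)

-- Recognising the exceptional tournament

permutations : List (List Move)
-- These six words in two adjacent transpositions give all orders of the last three parts.
permutations = [] ∷ (a ∷ []) ∷ (b ∷ []) ∷ (a ∷ b ∷ []) ∷ (b ∷ a ∷ []) ∷ (a ∷ b ∷ a ∷ []) ∷ []
  where
  a b : Move
  a = exchange 2F 3F
  b = exchange 3F 4F

contains : List V → Digraph → Digraph → Bool
contains vs D F = all (λ u → all (λ v → not (F u v) ∨ D u v) vs) vs

⇒⁻ : ∀ x {y} → T (not x ∨ y) → T x → T y
⇒⁻ true h _ = h

contains-sound : ∀ vs D F → T (contains vs D F) → ∀ {u v} → u ∈ vs → v ∈ vs → T (F u v) → T (D u v)
contains-sound vs D F h {u} {v} u∈ v∈ = ⇒⁻ (F u v)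
  (All.lookup (All.all⁺ (λ v → not (F u v) ∨ D u v) vs
    (All.lookup (All.all⁺ (λ u → all (λ v → not (F u v) ∨ D u v) vs) vs h) u∈)) v∈)

matches : Orientation 5 → Bool
matches o = any (λ ms → contains allV (relabelAll ms (arc o)) D₀) permutations

-- Containing `D₀` is enough: two tournaments on the same parts, one inside the other, are equal.
matches-sound : {D : Digraph} {o : Orientation 5} → Good D → o ⊑ encode D →
                T (matches o) → Isomorphic D₀ D
matches-sound {D} {o} g@(t , _) s h
  with ms , c ← Any.satisfied (Any.any⁻ (λ ms → contains allV (relabelAll ms (arc o)) D₀) permutations h) =
  Isomorphic-trans {F = D} (↔-refl , same) (relabelAll-isomorphic ms)
  where
  same : ∀ u v → relabelAll ms D u v ≡ D₀ u v
  same = subtournament-≡ D₀-tournament (proj₁ (relabelAll-good ms g))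
    (λ {u} {v} uv → relabelAll-mono ms (arc-sound t s)
      (contains-sound allV (relabelAll ms (arc o)) D₀ c (∈-allV u) (∈-allV v) uv))

-- The search

weight : Row n → ℕ
weight []            = 0
weight ((x , y) ∷ r) = bit x + (bit y + weight r)

weight-pairs : ∀ n (f : Vertex n → Bool) → weight (pairs f) ≡ degree n f
weight-pairs zero    f = refl
weight-pairs (suc n) f =
  cong (λ k → bit (f (0F , 0F)) + (bit (f (0F , 1F)) + k)) (weight-pairs n (f ∘ shift))

bits : ℕ → (Bool → ℕ → Bool) → Bool
bits zero    f = f false zero
bits (suc m) f = f true m ∧ f false (suc m)

bits-sound : ∀ m f → T (bits m f) → ∀ x k → bit x + k ≡ m → T (f x k)
bits-sound zero    f h false k refl = h
bits-sound (suc m) f h true  k refl = proj₁ (∧⁻ (f true m) h)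
bits-sound (suc m) f h false k refl = proj₂ (∧⁻ (f true m) h)

rows : ∀ n → ℕ → (Row n → Bool) → Bool
rows zero    zero    f = f []
-- No empty row has positive weight, so the conjunction over such rows is vacuous.
rows zero    (suc _) f = true
rows (suc n) m       f = bits m λ x m₁ → bits m₁ λ y m₂ → rows n m₂ λ r → f ((x , y) ∷ r)

rows-sound : ∀ n m f → T (rows n m f) → ∀ r → weight r ≡ m → T (f r)
rows-sound zero    zero f h []            eq = h
rows-sound (suc n) m    f h ((x , y) ∷ r) eq =
  rows-sound n _ _ (bits-sound _ _ (bits-sound m _ h x _ eq) y _ refl) r refl

-- The outdegree already used up by each of the remaining vertices
Load : ℕ → Set
Load n = Vec (ℕ × ℕ) n

pay : Row n → Row n → Load n → Load n
pay []             []             []              = []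
-- A later vertex spends outdegree on those of the two new vertices that have no arc to it.
pay ((x , x′) ∷ a) ((y , y′) ∷ b) ((l , l′) ∷ ls) =
  (l + (bit (not x) + bit (not y)) , l′ + (bit (not x′) + bit (not y′))) ∷ pay a b ls

at-pay : ∀ (a b : Row n) ls v →
         at (pay a b ls) v ≡ at ls v + (bit (not (at a v)) + bit (not (at b v)))
at-pay (_ ∷ _) (_ ∷ _) (_ ∷ _)  (zero  , 0F) = refl
at-pay (_ ∷ _) (_ ∷ _) (_ ∷ _)  (zero  , 1F) = refl
at-pay (_ ∷ a) (_ ∷ b) (_ ∷ ls) (suc j , 0F) = at-pay a b ls (j , 0F)
at-pay (_ ∷ a) (_ ∷ b) (_ ∷ ls) (suc j , 1F) = at-pay a b ls (j , 1F)

within : Load n → Bool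
within []              = true
within ((l , l′) ∷ ls) = (l ≤ᵇ 4) ∧ ((l′ ≤ᵇ 4) ∧ within ls)

within-complete : ∀ (ls : Load n) → (∀ v → at ls v ≤ 4) → T (within ls)
within-complete []       h = tt
within-complete (_ ∷ ls) h = Equivalence.from T-∧ (≤⇒≤ᵇ (h (0F , 0F)) ,
  Equivalence.from T-∧ (≤⇒≤ᵇ (h (0F , 1F)) ,
  within-complete ls λ { (j , 0F) → h (suc j , 0F) ; (j , 1F) → h (suc j , 1F) }))

-- `k` puts the arcs chosen so far around the parts still open, so `k unknown` is the current node.
-- The value is true when every branch is settled, overloads a vertex, or ends in a match.
search : Tables → ∀ n → (Orientation n → Orientation 5) → Load n → Bool
branch : Tables → ∀ n → (Orientation n → Orientation 5) → Load n → Bool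

search t n k ls = settled t (k unknown) ∨ branch t n k ls

branch t zero    k []              = matches (k unknown)
branch t (suc n) k ((l , l′) ∷ ls) =
  -- Arcs to earlier parts have used up `l` and `l′`; the rest of the outdegree 4 must go to later
  -- parts.
  rows n (4 ∸ l) λ a → rows n (4 ∸ l′) λ b →
    if within (pay a b ls) then search t n (k ∘ extend a b) (pay a b ls) else true

Found : Tables → (Orientation n → Orientation 5) → Graph n → Set
Found t k E = ∃ λ o → o ⊑ encode E × (T (settled t (k o)) ⊎ T (matches (k o)))

row-weight : {E : Graph (suc n)} → IsTournament E → ∀ x l →
             l + degree (suc n) (E (0F , x)) ≡ 4 → weight (row E x) ≡ 4 ∸ l
row-weight {n} {E} (same , _) x l eq
  rewrite same (0F , x) (0F , 0F) refl | same (0F , x) (0F , 1F) refl =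
  trans (weight-pairs n _) (trans (sym (m+n∸m≡n l _)) (cong (_∸ l) eq))

pay-degree : {E : Graph (suc n)} → IsTournament E → ∀ ls v →
             at ls v + degree (suc n) (E (shift v)) ≡ 4 →
             at (pay (row E 0F) (row E 1F) ls) v + degree n (restrict E v) ≡ 4
pay-degree {n} {E} t ls v eq = begin
  at (pay (row E 0F) (row E 1F) ls) v + d
    ≡⟨ cong (_+ d) (at-pay (row E 0F) (row E 1F) ls v) ⟩
  at ls v + (bit (not (at (row E 0F) v)) + bit (not (at (row E 1F) v))) + d
    ≡⟨ cong₂ (λ x y → at ls v + (bit x + bit y) + d) (back 0F) (back 1F) ⟩
  at ls v + (bit (E (shift v) (0F , 0F)) + bit (E (shift v) (0F , 1F))) + d
    ≡⟨ +-assoc (at ls v) _ d ⟩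
  at ls v + (bit (E (shift v) (0F , 0F)) + bit (E (shift v) (0F , 1F)) + d)
    ≡⟨ cong (at ls v +_) (+-assoc (bit (E (shift v) (0F , 0F))) _ d) ⟩
  at ls v + degree (suc n) (E (shift v))
    ≡⟨ eq ⟩
  4 ∎
  where
  open ≡-Reasoning
  d = degree n (restrict E v)
  back : ∀ x → not (at (row E x) v) ≡ E (shift v) (0F , x)
  back x = trans (cong not (at-pairs (E (0F , x) ∘ shift) v)) (sym (proj₂ t (0F , x) (shift v) λ ()))

-- The search is followed along the rows of `E` itself. Load plus outdegree among the open parts
-- stays 4, so these rows are enumerated and never rejected as overloaded, until a node is settled
-- or matches.
search-sound : ∀ t n k ls {E : Graph n} → IsTournament E →
               (∀ v → at ls v + degree n (E v) ≡ 4) → T (search t n k ls) → Found t k E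
branch-sound : ∀ t n k ls {E : Graph n} → IsTournament E →
               (∀ v → at ls v + degree n (E v) ≡ 4) → T (branch t n k ls) → Found t k E

search-sound t n k ls {E} tour degrees h with ∨⁻ (settled t (k unknown)) h
... | inj₁ s = unknown , unknown , inj₁ s
... | inj₂ b = branch-sound t n k ls {E} tour degrees b

branch-sound t zero    k []              tour degrees h = unknown , unknown , inj₂ h
branch-sound t (suc n) k ((l , l′) ∷ ls) {E} tour degrees h =
  let o , s , r = deeper in extend a b o , extend a b s , r
  where
  a = row E 0F
  b = row E 1F
  rest : T (if within (pay a b ls) then search t n (k ∘ extend a b) (pay a b ls) else true)
  rest = rows-sound n (4 ∸ l′) _
    (rows-sound n (4 ∸ l) _ h a (row-weight {E = E} tour 0F l (degrees (0F , 0F))))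
    b (row-weight {E = E} tour 1F l′ (degrees (0F , 1F)))
  degrees′ : ∀ v → at (pay a b ls) v + degree n (restrict E v) ≡ 4
  degrees′ v = pay-degree {E = E} tour ls v (shifted v)
    where
    shifted : ∀ v → at ls v + degree (suc n) (E (shift v)) ≡ 4
    shifted (j , 0F) = degrees (suc j , 0F)
    shifted (j , 1F) = degrees (suc j , 1F)
  if-true : ∀ {x y} → T x → T (if x then y else true) → T y
  if-true {true} _ y = y
  deeper : Found t (k ∘ extend a b) (restrict E)
  deeper = search-sound t n (k ∘ extend a b) (pay a b ls) (restrict-tournament {E = E} tour) degrees′
    (if-true (within-complete (pay a b ls) λ v → subst (at (pay a b ls) v ≤_) (degrees′ v) (m≤m+n _ _)) rest)

-- The search result is an equation, because every reduction of a T-type would run the search again.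
search-≡true-sound : ∀ t n k ls {E : Graph n} → IsTournament E →
                     (∀ v → at ls v + degree n (E v) ≡ 4) → search t n k ls ≡ true → Found t k E
search-≡true-sound t n k ls {E} tour degrees eq = search-sound t n k ls {E} tour degrees (T-true eq)

whole : Orientation 5 → Orientation 5
whole o = o

unloaded : Load 5
unloaded = replicate 5 (0 , 0)

-- The entire case analysis is carried out here, by evaluation.
search-succeeds : search tables 5 whole unloaded ≡ true
search-succeeds = refl

-- Outdegrees and the conclusion

sum-map-+ : (f g : A → ℕ) → ∀ xs → sum (map f xs) + sum (map g xs) ≡ sum (map (λ x → f x + g x) xs)
sum-map-+ f g []       = refl
sum-map-+ f g (x ∷ xs) =
  trans (interchange (f x) _ (g x) _) (cong (f x + g x +_) (sum-map-+ f g xs))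

-- Each of the 8 vertices in other parts contributes one arc at `u`, so indegree and outdegree add
-- up to 8.
outdeg-regular : ∀ {D} → IsTournament D → Regular D → ∀ u → outdeg D u ≡ 4
outdeg-regular {D} (same , diff) reg u = *-cancelˡ-≡ (outdeg D u) 4 2 (begin
  outdeg D u + (outdeg D u + 0)
    ≡⟨ cong (outdeg D u +_) (trans (+-identityʳ _) (sym (reg u))) ⟩
  outdeg D u + indeg D u
    ≡⟨ sum-map-+ (λ v → bit (D u v)) (λ v → bit (D v u)) allV ⟩
  sum (map (λ v → bit (D u v) + bit (D v u)) allV)
    ≡⟨ cong sum (map-cong one-arc allV) ⟩
  count (λ v → not ⌊ part u ≟ part v ⌋)
    ≡⟨ from-yes (allVertices? λ u → count (λ v → not ⌊ part u ≟ part v ⌋) ≟ℕ 8) u ⟩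
  8 ∎)
  where
  open ≡-Reasoning
  one-arc : ∀ v → bit (D u v) + bit (D v u) ≡ bit (not ⌊ part u ≟ part v ⌋)
  one-arc v with part u ≟ part v
  ... | yes eq = cong₂ (λ x y → bit x + bit y) (same u v eq) (same v u (sym eq))
  ... | no neq rewrite diff u v neq with D u v
  ...   | true  = refl
  ...   | false = refl

at-replicate : (x : A) → ∀ v → at (replicate n (x , x)) v ≡ x
at-replicate x (j , 0F) = cong proj₁ (lookup-replicate j _)
at-replicate x (j , 1F) = cong proj₂ (lookup-replicate j _)

found : ∀ {D} → IsTournament D → Regular D → Found tables whole D
found {D} t reg = search-≡true-sound tables 5 whole unloaded {D} t degrees search-succeeds
  where
  degrees : ∀ v → at unloaded v + degree 5 (D v) ≡ 4
  -- `degree 5 (D v)` and `outdeg D v` unfold to the same sum.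
  degrees v = trans (cong (_+ degree 5 (D v)) (at-replicate 0 v)) (outdeg-regular {D} t reg v)

-- A settled node would give an improving move or a strong partition, both excluded here; only a
-- match remains.
normal-isomorphic : ∀ {D} → Good D → ¬ Improvable D → Found tables whole D → Isomorphic D₀ D
normal-isomorphic     g              ¬imp (o , s , inj₂ m) = matches-sound g s m
normal-isomorphic {D} (t , _ , none) ¬imp (o , s , inj₁ h) =
  [ (λ imp → contradiction imp ¬imp) , (λ sp → contradiction sp none) ]′ (settled-sound {D} t s h)

theorem3p3 : Σ Digraph λ D → Good D × (∀ D' → Good D' → Isomorphic D D')
theorem3p3 = D₀ , D₀-good , isomorphic
  where
  isomorphic : ∀ D → Good D → Isomorphic D₀ D
  isomorphic D g =
    -- `D` is replaced by a relabelling that no move improves; this one is still good, and its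
    -- isomorphism with `D₀` carries over to `D`.
    let ms , ¬imp        = minimise D (<-wellFounded (key D))
        E                = relabelAll ms D
        g′@(t , reg , _) = relabelAll-good ms g
    in Isomorphic-trans {F = D} (normal-isomorphic {E} g′ ¬imp (found {E} t reg)) (relabelAll-isomorphic ms)
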